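{- $\mathrm{TPTL}[F]\not\subseteq\mathrm{MTL}[U,S]$ over strictly monotonic timed words, and hence also over weakly monotonic timed words: there is a TPTL$[F]$ formula $\phi$ such that no MTL$[U,S]$ formula $\psi$ is satisfied (at position 1) by exactly the same strictly monotonic timed words as $\phi$.
   Context: Fix a finite alphabet $\Sigma$. A (weakly monotonic) timed word is $\rho=(\sigma_1,\tau_1)\cdots(\sigma_n,\tau_n)$, $n\ge1$, $\sigma_i\in\Sigma$, $\tau_i\in\mathbb{R}_{\ge0}$, $\tau_1=0$, $\tau_i\le\tau_{i+1}$; strictly monotonic if $\tau_i<\tau_{i+1}$. An interval is a convex subset of $\mathbb{R}_{\ge0}$ with endpoints non-negative integers or $\infty$. MTL$[U,S]$: $\phi::=a\mid\phi\wedge\phi\mid\neg\phi\mid\phi U_I\phi\mid\phi S_I\phi$ ($a\in\Sigma$, $I$ any interval), with $\rho,i\models a$ iff $\sigma_i=a$, $\rho,i\models\phi_1U_I\phi_2$ iff $\exists j>i$: $\rho,j\models\phi_2$, $\tau_j-\tau_i\in I$, $\forall i<k<j$: $\rho,k\models\phi_1$; $\rho,i\models\phi_1S_I\phi_2$ iff $\exists j<i$: $\rho,j\models\phi_2$, $\tau_i-\tau_j\in I$, $\forall j<k<i$: $\rho,k\models\phi_1$. TPTL$[F]$: fix a finite set $\mathcal{X}$ of freeze variables; valuations $\nu:\mathcal{X}\to\mathbb{R}_{\ge0}$, $\nu_0\equiv0$; guards $g::=g\wedge g\mid x-T\approx c$ with $\approx\in\{<,\le,>,\ge,=\}$, $c\in\mathbb{Z}$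 (so $T-x\approx c$ is also expressible), $\nu,t\models x-T\approx c$ iff $\nu(x)-t\approx c$; formulas $\phi::=a\mid g\mid F\phi\mid x.\phi\mid\phi\vee\phi\mid\neg\phi$, with $\rho,i,\nu\models g$ iff $\nu,\tau_i\models g$, $\rho,i,\nu\models F\phi$ iff $\exists j>i$: $\rho,j,\nu\models\phi$, $\rho,i,\nu\models x.\phi$ iff $\rho,i,\nu[x\mapsto\tau_i]\models\phi$. A TPTL formula holds of $\rho$ if $\rho,1,\nu_0\models\phi$; an MTL formula if $\rho,1\models\psi$. -}

module Defs where

open import Data.Nat as ℕ using (ℕ; zero; suc; _≟_)
open import Data.Integer as ℤ using (ℤ; +_; -[1+_])
open import Data.Fin as Fin using (Fin)
open import Data.Product using (Σ; ∃; _×_; _,_)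
open import Data.Sum using (_⊎_)
open import Data.Empty using (⊥)
open import Relation.Nullary using (¬_; yes; no)
open import Relation.Binary.PropositionalEquality using (_≡_)
open import Relation.Binary.Structures using (IsStrictTotalOrder)
open import Algebra.Structures using (IsCommutativeRing)
open import Function.Bundles using (_⇔_)

record RealField : Set₁ where
  infixl 6 _+_
  infixl 7 _*_
  infix 4 _<_ _≤_
  field
    ℝ   : Set
    0ℝ 1ℝ : ℝ
    _+_ _*_ : ℝ → ℝ → ℝ
    -_  : ℝ → ℝ
    _<_ : ℝ → ℝ → Set
    isCommutativeRing : IsCommutativeRing _≡_ _+_ _*_ -_ 0ℝ 1ℝ
    isStrictTotalOrder : IsStrictTotalOrder _≡_ _<_
    0<1 : 0ℝ < 1ℝ
    inverse : ∀ x → ¬ (x ≡ 0ℝ) → ∃ λ y → x * y ≡ 1ℝ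
    +-mono-< : ∀ x y z → x < y → x + z < y + z
    *-pos : ∀ x y → 0ℝ < x → 0ℝ < y → 0ℝ < x * y

  _≤_ : ℝ → ℝ → Set
  x ≤ y = x < y ⊎ x ≡ y

  field
    complete : (P : ℝ → Set) → (∃ λ x → P x) →
               (∃ λ b → ∀ x → P x → x ≤ b) →
               ∃ λ s → (∀ x → P x → x ≤ s) × (∀ b → (∀ x → P x → x ≤ b) → s ≤ b)

  _-_ : ℝ → ℝ → ℝ
  x - y = x + (- y)

  fromℕ : ℕ → ℝ
  fromℕ zero    = 0ℝ
  fromℕ (suc n) = 1ℝ + fromℕ n

  fromℤ : ℤ → ℝ
  fromℤ (+ n)      = fromℕ n
  fromℤ -[1+ n ]   = - fromℕ (suc n)

data Lower : Set where
  closedL : ℕ → Lower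
  openL   : ℕ → Lower

data Upper : Set where
  closedU : ℕ → Upper
  openU   : ℕ → Upper
  ∞       : Upper

record Interval : Set where
  constructor ⟨_,_⟩
  field
    lower : Lower
    upper : Upper

-- Syntax (alphabet Σ = Fin k, freeze variables indexed by ℕ)

data MTL (k : ℕ) : Set where
  atom : Fin k → MTL k
  _∧_  : MTL k → MTL k → MTL k
  ¬'_  : MTL k → MTL k
  _U[_]_ : MTL k → Interval → MTL k → MTL k
  _S[_]_ : MTL k → Interval → MTL k → MTL k

data Cmp : Set where
  lt le gt ge eq : Cmp

data Guard : Set where
  _∧g_ : Guard → Guard → Guard
  diff : (x : ℕ) → Cmp → ℤ → Guard

data TPTL (k : ℕ) : Set where
  atom   : Fin k → TPTL k
  guard  : Guard → TPTL k
  F      : TPTL k → TPTL k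
  freeze : (x : ℕ) → TPTL k → TPTL k
  _∨_    : TPTL k → TPTL k → TPTL k
  ¬'_    : TPTL k → TPTL k

module Semantics (R : RealField) where
  open RealField R

  -- timed word over Σ = Fin k with n+1 ≥ 1 positions 0 … n (position 1 of
  -- the paper is Fin.zero)
  record TimedWord (k : ℕ) : Set where
    field
      len   : ℕ                   -- number of positions minus one
      σ     : Fin (suc len) → Fin k
      τ     : Fin (suc len) → ℝ
      τ-0   : τ Fin.zero ≡ 0ℝ
  open TimedWord public

  WeaklyMonotonic : ∀ {k} → TimedWord k → Set
  WeaklyMonotonic w = ∀ i j → i Fin.< j → τ w i ≤ τ w j

  StrictlyMonotonic : ∀ {k} → TimedWord k → Set
  StrictlyMonotonic w = ∀ i j → i Fin.< j → τ w i < τ w j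

  _∈L_ : ℝ → Lower → Set
  r ∈L closedL l = fromℕ l ≤ r
  r ∈L openL l   = fromℕ l < r

  _∈U_ : ℝ → Upper → Set
  r ∈U closedU u = r ≤ fromℕ u
  r ∈U openU u   = r < fromℕ u
  r ∈U ∞         = Data.Unit.⊤ where import Data.Unit

  _∈I_ : ℝ → Interval → Set
  r ∈I ⟨ l , u ⟩ = (r ∈L l) × (r ∈U u)

  _,_⊨M_ : ∀ {k} (w : TimedWord k) → Fin (suc (len w)) → MTL k → Set
  w , i ⊨M atom a = σ w i ≡ a
  w , i ⊨M (φ ∧ ψ) = (w , i ⊨M φ) × (w , i ⊨M ψ)
  w , i ⊨M (¬' φ) = ¬ (w , i ⊨M φ)
  w , i ⊨M (φ U[ I ] ψ) =
    Σ (Fin (suc (len w))) λ j → i Fin.< j × (w , j ⊨M ψ) × ((τ w j - τ w i) ∈I I)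
      × (∀ m → i Fin.< m → m Fin.< j → w , m ⊨M φ)
  w , i ⊨M (φ S[ I ] ψ) =
    Σ (Fin (suc (len w))) λ j → j Fin.< i × (w , j ⊨M ψ) × ((τ w i - τ w j) ∈I I)
      × (∀ m → j Fin.< m → m Fin.< i → w , m ⊨M φ)

  Valuation : Set
  Valuation = ℕ → ℝ

  ν₀ : Valuation
  ν₀ _ = 0ℝ

  _[_↦_] : Valuation → ℕ → ℝ → Valuation
  (ν [ x ↦ t ]) y with y ≟ x
  ... | yes _ = t
  ... | no _  = ν y

  cmp : Cmp → ℝ → ℝ → Set
  cmp lt a b = a < b
  cmp le a b = a ≤ b
  cmp gt a b = b < a
  cmp ge a b = b ≤ a
  cmp eq a b = a ≡ b

  _,_⊨G_ : Valuation → ℝ → Guard → Set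
  ν , t ⊨G (g ∧g h) = (ν , t ⊨G g) × (ν , t ⊨G h)
  ν , t ⊨G diff x c z = cmp c (ν x - t) (fromℤ z)

  _,_,_⊨T_ : ∀ {k} (w : TimedWord k) → Fin (suc (len w)) → Valuation → TPTL k → Set
  w , i , ν ⊨T atom a = σ w i ≡ a
  w , i , ν ⊨T guard g = ν , τ w i ⊨G g
  w , i , ν ⊨T F φ = Σ (Fin (suc (len w))) λ j → i Fin.< j × (w , j , ν ⊨T φ)
  w , i , ν ⊨T freeze x φ = w , i , (ν [ x ↦ τ w i ]) ⊨T φ
  w , i , ν ⊨T (φ ∨ ψ) = (w , i , ν ⊨T φ) ⊎ (w , i , ν ⊨T ψ)
  w , i , ν ⊨T (¬' φ) = ¬ (w , i , ν ⊨T φ)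

  EquivalentOver : ∀ {k} → (TimedWord k → Set) → TPTL k → MTL k → Set
  EquivalentOver {k} C φ ψ =
    (w : TimedWord k) → C w → (w , Fin.zero , ν₀ ⊨T φ) ⇔ (w , Fin.zero ⊨M ψ)

{-# OPTIONS --safe #-}

-- Take words with N events in the time interval [0,1) and N events in (1,2), and
-- overlay the two clusters by subtracting 1 from the later times.  One word
-- interleaves the clusters strictly alternately; the other differs from it by
-- swapping one neighbouring pair, deep in the middle.  The swap makes two
-- consecutive early events x, y have no event in (x+1, y+1), which TPTL[F] detects.
-- For MTL[U,S] the distance between two events only matters through its position
-- relative to 0, 1, 2, i.e. through the order in the overlay.  By induction on the
-- formula, events of one cluster that are far from both ends of the cluster satisfy
-- the same formulas in both words: a move across the clusters to an event in the
-- middle can be answered by any other event in the middle on the correct side, so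
-- the swap is invisible.
module Submission where

open import Defs
open import Data.Nat using (ℕ; zero; suc; _+_; _*_; _≤_; _<_; z≤n; s≤s; z<s; _≟_; _≤?_; _<?_; _⊔_)
open import Data.Nat.Properties
open import Data.Nat.Tactic.RingSolver using (solve)
open import Data.Bool using (Bool; true; false; if_then_else_) renaming (_∧_ to _and_)
open import Data.Fin using (Fin; toℕ; fromℕ<)
open import Data.Fin.Properties using (toℕ<n; toℕ-fromℕ<)
open import Data.Integer using (-[1+_])
open import Data.List using ([]; _∷_)
open import Data.Product using (Σ; ∃; _×_; _,_; proj₁; proj₂)
open import Data.Sum using (_⊎_; inj₁; inj₂)
open import Data.Empty using (⊥; ⊥-elim)
open import Algebra.Bundles using (CommutativeRing)
import Algebra.Properties.AbelianGroup as GroupProperties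
import Algebra.Properties.Ring as RingProperties
open import Relation.Binary.Structures using (IsStrictTotalOrder)
open import Function.Bundles using (Equivalence)
open import Relation.Nullary using (¬_; Dec; does; yes; no)
open import Relation.Nullary.Decidable using (dec-true; dec-false)
open import Relation.Binary.Definitions using (tri<; tri≈; tri>)
open import Relation.Binary.PropositionalEquality using (_≡_; _≢_; refl; sym; trans; cong; subst; subst₂)

-- Adding up inequalities and comparing the total with the goal; the equation is
-- left to the ring solver.
linear : ∀ {a b x y} d → a ≤ b → x + b + d ≡ y + a → x ≤ y
linear {a} {b} {x} {y} d a≤b e≡ =
  +-cancelʳ-≤ a x y (≤-trans (+-monoʳ-≤ x a≤b) (≤-trans (m≤m+n (x + b) d) (≤-reflexive e≡)))

triple : ∀ {a b} → a ≤ b → 3 * a ≤ 3 * b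
triple = *-monoʳ-≤ 3

-- The two clusters in integer time.

module Discrete (N m : ℕ) (m<N : m < N) where

  -- Times are measured in units of 1/(3N), so that position N + i, the i-th event of
  -- the second cluster, is overlaid at 3i + 1, just after the event i at 3i.  The
  -- flag moves event m to 3m + 2, past its partner.
  shift : Bool → ℕ → ℕ
  shift b p = if does (p <? N) then (if b and does (p ≟ m) then 2 else 0) else 1

  time : Bool → ℕ → ℕ
  time b p = shift b p + 3 * p

  shift≤2 : ∀ b p → shift b p ≤ 2
  shift≤2 b p with does (p <? N) | b and does (p ≟ m)
  ... | true  | true  = s≤s (s≤s z≤n)
  ... | true  | false = z≤n
  ... | false | _     = s≤s z≤n

  shift-left : ∀ b p → p < N → shift b p ≡ 0 ⊎ shift b p ≡ 2
  shift-left b p p<N with does (p <? N) | dec-true (p <? N) p<N | b and does (p ≟ m)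
  ... | true | _ | true  = inj₂ refl
  ... | true | _ | false = inj₁ refl

  shift-right : ∀ b p → N ≤ p → shift b p ≡ 1
  shift-right b p N≤p with does (p <? N) | dec-false (p <? N) (≤⇒≯ N≤p)
  ... | false | _ = refl

  shift-false : ∀ p → p < N → shift false p ≡ 0
  shift-false p p<N with does (p <? N) | dec-true (p <? N) p<N
  ... | true | _ = refl

  shift-defect : shift true m ≡ 2
  shift-defect with does (m <? N) | dec-true (m <? N) m<N | does (m ≟ m) | dec-true (m ≟ m) refl
  ... | true | _ | true | _ = refl

  shift-agree : ∀ b b′ p → p ≢ m → shift b p ≡ shift b′ p
  shift-agree b b′ p p≢m with does (p <? N) | does (p ≟ m) | dec-false (p ≟ m) p≢m
  shift-agree true  true  p p≢m | true  | false | _ = refl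
  shift-agree true  false p p≢m | true  | false | _ = refl
  shift-agree false true  p p≢m | true  | false | _ = refl
  shift-agree false false p p≢m | true  | false | _ = refl
  shift-agree b     b′    p p≢m | false | false | _ = refl

  time-lower : ∀ b p → 3 * p ≤ time b p
  time-lower b p = m≤n+m (3 * p) (shift b p)

  time-upper : ∀ b p → time b p ≤ 2 + 3 * p
  time-upper b p = +-monoˡ-≤ (3 * p) (shift≤2 b p)

  time-mono : ∀ b {p r} → p < r → time b p < time b r
  time-mono b {p} {r} p<r = below (time-upper b p) (time-lower b r)
    where
    below : ∀ {x y} → x ≤ 2 + 3 * p → 3 * r ≤ y → x < y
    below {x} {y} hx hy =
      linear 0 (+-mono-≤ (+-mono-≤ hx hy) (triple p<r)) (solve (p ∷ r ∷ x ∷ y ∷ []))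

  -- `3 * N` is one time unit. Open cells suffice, since distinct events are never a whole number of
  -- units apart.
  Cell : Bool → ℕ → ℕ → ℕ → Set
  Cell b n p r = time b p + n * (3 * N) < time b r × time b r < time b p + suc n * (3 * N)

  -- Shifts are at most 2, less than the spacing 3, so index order decides the cell unless `r` is
  -- the counterpart `N + p`; likewise in `far`.
  near : ∀ b {p r} → p < r → r < N + p → Cell b 0 p r
  near b {p} {r} p<r r<N+p =
    subst (_< time b r) (sym (+-identityʳ (time b p))) (time-mono b p<r) ,
    below (time-lower b p) (time-upper b r)
    where
    below : ∀ {x y} → 3 * p ≤ x → y ≤ 2 + 3 * r → y < x + 1 * (3 * N)
    below {x} {y} hx hy =
      linear 0 (+-mono-≤ (+-mono-≤ hx hy) (triple r<N+p)) (solve (N ∷ p ∷ r ∷ x ∷ y ∷ []))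

  far : ∀ b {p r} → N + p < r → r < N + N → Cell b 1 p r
  far b {p} {r} N+p<r r<2N =
    above (time-upper b p) (time-lower b r) , below (time-lower b p) (time-upper b r)
    where
    above : ∀ {x y} → x ≤ 2 + 3 * p → 3 * r ≤ y → x + 1 * (3 * N) < y
    above {x} {y} hx hy =
      linear 0 (+-mono-≤ (+-mono-≤ hx hy) (triple N+p<r)) (solve (N ∷ p ∷ r ∷ x ∷ y ∷ []))
    below : ∀ {x y} → 3 * p ≤ x → y ≤ 2 + 3 * r → y < x + 2 * (3 * N)
    below {x} {y} hx hy =
      linear (3 * p) (+-mono-≤ (+-mono-≤ hx hy) (triple r<2N)) (solve (N ∷ p ∷ r ∷ x ∷ y ∷ []))

  -- The one pair whose cell depends on the shift: the counterpart is overlaid at `1 + 3 * p`, after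
  -- an unmoved `p` but before a moved one.
  opposite-far : ∀ b {p} → p < N → shift b p ≡ 0 → Cell b 1 p (N + p)
  opposite-far b {p} p<N e≡ rewrite e≡ | shift-right b (N + p) (m≤m+n N p) =
    linear 0 (z≤n {0}) (solve (N ∷ p ∷ [])) ,
    linear (1 + 3 * p) (triple p<N) (solve (N ∷ p ∷ []))

  opposite-near : ∀ b {p} → p < N → shift b p ≡ 2 → Cell b 0 p (N + p)
  opposite-near b {p} p<N e≡ rewrite e≡ | shift-right b (N + p) (m≤m+n N p) =
    linear (1 + 3 * p) (triple p<N) (solve (N ∷ p ∷ [])) ,
    linear 0 (z≤n {0}) (solve (N ∷ p ∷ []))

  left-of-opposite : ∀ {p r} → r ≡ N + p → r < N + N → p < N
  left-of-opposite {p} refl r<2N = +-cancelˡ-< N p N r<2N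

  near-or-far : ∀ b {p r} → p < r → r < N + N → Cell b 0 p r ⊎ Cell b 1 p r
  near-or-far b {p} {r} p<r r<2N with <-cmp r (N + p)
  ... | tri< r<N+p _ _ = inj₁ (near b p<r r<N+p)
  ... | tri> _ _ N+p<r = inj₂ (far b N+p<r r<2N)
  ... | tri≈ _ refl _ with shift-left b p (left-of-opposite refl r<2N)
  ...   | inj₁ e≡ = inj₂ (opposite-far b (left-of-opposite refl r<2N) e≡)
  ...   | inj₂ e≡ = inj₁ (opposite-near b (left-of-opposite refl r<2N) e≡)

  SameCell : Bool → ℕ → ℕ → Bool → ℕ → ℕ → Set
  SameCell b p r b′ q r′ = ∃ λ n → Cell b n p r × Cell b′ n q r′

  both-near : ∀ b b′ {p r q r′} → p < r → r < N + p → q < r′ → r′ < N + q → SameCell b p r b′ q r′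
  both-near b b′ p<r r<N+p q<r′ r′<N+q = 0 , near b p<r r<N+p , near b′ q<r′ r′<N+q

  both-far : ∀ b b′ {p r q r′} → N + p < r → r < N + N → N + q < r′ → r′ < N + N → SameCell b p r b′ q r′
  both-far b b′ N+p<r r<2N N+q<r′ r′<2N = 1 , far b N+p<r r<2N , far b′ N+q<r′ r′<2N

  -- Moving `m` can change the cell of the pair `m`, `N + m` only, and the last hypothesis excludes
  -- that pair.
  same-cell : ∀ b b′ {p r} → p < r → r < N + N → (r ≡ N + p → p ≢ m) → SameCell b p r b′ p r
  same-cell b b′ {p} {r} p<r r<2N p≢m with <-cmp r (N + p)
  ... | tri< r<N+p _ _ = both-near b b′ p<r r<N+p p<r r<N+p
  ... | tri> _ _ N+p<r = both-far b b′ N+p<r r<2N N+p<r r<2N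
  ... | tri≈ _ refl _ with shift-left b p (left-of-opposite refl r<2N)
  ...   | inj₁ e≡ = 1 , opposite-far b (left-of-opposite refl r<2N) e≡
                      , opposite-far b′ (left-of-opposite refl r<2N) (trans (shift-agree b′ b p (p≢m refl)) e≡)
  ...   | inj₂ e≡ = 0 , opposite-near b (left-of-opposite refl r<2N) e≡
                      , opposite-near b′ (left-of-opposite refl r<2N) (trans (shift-agree b′ b p (p≢m refl)) e≡)

  -- Similar positions and replies to moves.

  Mid : ℕ → ℕ → Set
  Mid k i = k ≤ i × k + i < N

  base : Bool → ℕ
  base false = 0
  base true  = N

  -- Deep positions of one cluster are interchangeable; a position near an end is related only to
  -- itself. No flag occurs, so the relation serves any pair of the words.
  data Sim (k : ℕ) : ℕ → ℕ → Set where
    same : ∀ {p} → Sim k p p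
    mid  : ∀ c {i i′} → Mid k i → Mid k i′ → Sim k (base c + i) (base c + i′)

  Sim-sym : ∀ {k p q} → Sim k p q → Sim k q p
  Sim-sym same        = same
  Sim-sym (mid c h h′) = mid c h′ h

  Mid-suc : ∀ {k i} → Mid (2 + k) i → Mid k (suc i)
  Mid-suc {k} {i} (lo , hi) =
    linear 3 lo (solve (k ∷ i ∷ [])) , linear 1 hi (solve (N ∷ k ∷ i ∷ []))

  Mid-pred : ∀ {k i} → Mid (2 + k) (suc i) → Mid k i
  Mid-pred {k} {i} (lo , hi) =
    linear 1 lo (solve (k ∷ i ∷ [])) , linear 3 hi (solve (N ∷ k ∷ i ∷ []))

  Mid-weaken : ∀ {k k′ i} → k′ ≤ k → Mid k i → Mid k′ i
  Mid-weaken {i = i} k′≤k (lo , hi) = ≤-trans k′≤k lo , ≤-<-trans (+-monoˡ-≤ i k′≤k) hi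

  data View : ℕ → Set where
    inCluster : ∀ c {i} → i < N → View (base c + i)

  view : ∀ r → r < N + N → View r
  view r r<2N with r <? N
  ... | yes r<N = inCluster false r<N
  ... | no r≮N with m≤n⇒∃[o]m+o≡n (≮⇒≥ r≮N)
  ...   | i , refl = inCluster true (+-cancelˡ-< N i N r<2N)

  base-bound : ∀ c {i} → i < N → base c + i < N + N
  base-bound false {i} i<N = <-≤-trans i<N (m≤m+n N N)
  base-bound true  {i} i<N = +-monoʳ-< N i<N

  -- r′ answers the move from p to r: every event between q and r′ has a counterpart
  -- between p and r, which is what transferring an Until requires.
  RightReply : ℕ → Bool → Bool → ℕ → ℕ → ℕ → ℕ → Set
  RightReply k b b′ p q r r′ = q < r′ × Sim k r r′ × SameCell b p r b′ q r′
    × (∀ s′ → q < s′ → s′ < r′ → ∃ λ s → p < s × s < r × Sim k s s′)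

  LeftReply : ℕ → Bool → Bool → ℕ → ℕ → ℕ → ℕ → Set
  LeftReply k b b′ p q r r′ = r′ < q × Sim k r r′ × SameCell b r p b′ r′ q
    × (∀ s′ → r′ < s′ → s′ < q → ∃ λ s → r < s × s < p × Sim k s s′)

  Right : ℕ → Bool → Bool → ℕ → ℕ → ℕ → Set
  Right k b b′ p q r = ∃ λ r′ → r′ < N + N × RightReply k b b′ p q r r′

  Left : ℕ → Bool → Bool → ℕ → ℕ → ℕ → Set
  Left k b b′ p q r = ∃ λ r′ → r′ < N + N × LeftReply k b b′ p q r r′

  -- Replies within one cluster.

  between : ∀ c {i l s} → base c + i < s → s < base c + l → ∃ λ j → s ≡ base c + j × i < j × j < l
  between c {i} {l} {s} lo hi with m≤n⇒∃[o]m+o≡n (≤-trans (m≤m+n (base c) i) (<⇒≤ lo))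
  ... | j , refl = j , refl , +-cancelˡ-< (base c) i j lo , +-cancelˡ-< (base c) j l hi

  cluster-near : ∀ c {i l} → l < N → base c + l < N + (base c + i)
  cluster-near c {i} {l} l<N = go (base c)
    where
    go : ∀ o → o + l < N + (o + i)
    go o = linear i l<N (solve (N ∷ o ∷ i ∷ l ∷ []))

  -- Provides counterparts for intermediate events. While `j` keeps margin `k` at the upper end,
  -- `suc i` stands in for it; otherwise `j` is so late that it lies beyond `i` too and answers
  -- itself. The disjunction lets callers bound the answer from above.
  up : ∀ c {k i i′ j} → Mid (2 + k) i → Mid (2 + k) i′ → i′ < j →
       ∃ λ h → i < h × (h ≡ suc i ⊎ h ≡ j) × Sim k (base c + h) (base c + j)
  up c {k} {i} {i′} {j} mi mi′ i′<j with k + j <? N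
  ... | yes hj = suc i , ≤-refl , inj₁ refl ,
                 mid c (Mid-suc mi) (≤-trans (≤-trans (m≤n+m k 2) (proj₁ mi′)) (<⇒≤ i′<j) , hj)
  ... | no ¬hj = j , linear 2 (+-mono-≤ (proj₂ mi) (≮⇒≥ ¬hj)) (solve (N ∷ k ∷ i ∷ j ∷ [])) ,
                 inj₂ refl , same

  down : ∀ c {k i i′ j} → Mid (2 + k) (suc i) → Mid (2 + k) i′ → j < i′ →
         ∃ λ h → h < suc i × (h ≡ i ⊎ h ≡ j) × Sim k (base c + h) (base c + j)
  down c {k} {i} {i′} {j} mi mi′ j<i′ with k ≤? j
  ... | yes hj = i , ≤-refl , inj₁ refl , mid c (Mid-pred mi)
                 (hj , linear 3 (+-mono-≤ (proj₂ mi′) j<i′) (solve (N ∷ k ∷ i′ ∷ j ∷ [])))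
  ... | no ¬hj = j , linear 2 (+-mono-≤ (proj₁ mi) (≰⇒> ¬hj)) (solve (k ∷ i ∷ j ∷ [])) ,
                 inj₂ refl , same

  -- Within a cluster every distance is below one unit. If `l` is not near the upper end, the
  -- adjacent event `suc i′` is a reply with nothing in between; otherwise `l` lies beyond both `i`
  -- and `i′` and is its own reply.
  inside-right : ∀ c {k b b′ i i′ l} → Mid (2 + k) i → Mid (2 + k) i′ → i < l → l < N →
                 Right k b b′ (base c + i) (base c + i′) (base c + l)
  inside-right c {k} {b} {b′} {i} {i′} {l} mi mi′ i<l l<N with suc k + l <? N
  ... | yes hl = base c + suc i′ , base-bound c si′<N , q<r′ , mid c ml (Mid-suc mi′) ,
        both-near b b′ (+-monoʳ-< (base c) i<l) (cluster-near c l<N) q<r′ (cluster-near c si′<N) ,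
        λ s′ lo hi → ⊥-elim (<⇒≱ lo (≤-pred (subst (s′ <_) (+-suc (base c) i′) hi)))
    where
    si′<N : suc i′ < N
    si′<N = ≤-<-trans (m≤n+m (suc i′) k) (proj₂ (Mid-suc {k} mi′))
    q<r′ : base c + i′ < base c + suc i′
    q<r′ = +-monoʳ-< (base c) ≤-refl
    ml : Mid k l
    ml = ≤-trans (≤-trans (m≤n+m k 2) (proj₁ mi)) (<⇒≤ i<l) , <⇒≤ hl
  ... | no ¬hl = base c + l , base-bound c l<N , +-monoʳ-< (base c) i′<l , same ,
        both-near b b′ (+-monoʳ-< (base c) i<l) (cluster-near c l<N)
                       (+-monoʳ-< (base c) i′<l) (cluster-near c l<N) ,
        answer
    where
    i′<l : i′ < l
    i′<l = linear 1 (+-mono-≤ (proj₂ mi′) (≮⇒≥ ¬hl)) (solve (N ∷ k ∷ i′ ∷ l ∷ []))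
    -- `up` may answer with `suc i`, which must still precede the target.
    si<l : suc i < l
    si<l = linear 0 (+-mono-≤ (proj₂ mi) (≮⇒≥ ¬hl)) (solve (N ∷ k ∷ i ∷ l ∷ []))
    answer : ∀ s′ → base c + i′ < s′ → s′ < base c + l →
             ∃ λ s → base c + i < s × s < base c + l × Sim k s s′
    answer s′ lo hi with between c lo hi
    ... | j , refl , i′<j , j<l with up c mi mi′ i′<j
    ...   | h , i<h , inj₁ refl , sim = base c + h , +-monoʳ-< (base c) i<h , +-monoʳ-< (base c) si<l , sim
    ...   | h , i<h , inj₂ refl , sim = base c + h , +-monoʳ-< (base c) i<h , +-monoʳ-< (base c) j<l , sim

  -- Mirror image of `inside-right`, with the predecessor of `i′` as adjacent reply; it exists
  -- because `Mid (2 + k)` excludes index 0.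
  inside-left : ∀ c {k b b′ i i′ l} → Mid (2 + k) i → Mid (2 + k) i′ → l < i →
                Left k b b′ (base c + i) (base c + i′) (base c + l)
  inside-left c {k} {b} {b′} {suc i} {suc i′} {l} mi mi′ l<i with suc k ≤? l
  ... | yes hl = base c + i′ , base-bound c (<⇒≤ i′<N) , r′<q , mid c ml (Mid-pred mi′) ,
        both-near b b′ (+-monoʳ-< (base c) l<i) (cluster-near c i<N) r′<q (cluster-near c i′<N) ,
        λ s′ lo hi → ⊥-elim (<⇒≱ lo (≤-pred (subst (s′ <_) (+-suc (base c) i′) hi)))
    where
    i<N : suc i < N
    i<N = ≤-<-trans (m≤n+m (suc i) (2 + k)) (proj₂ mi)
    i′<N : suc i′ < N
    i′<N = ≤-<-trans (m≤n+m (suc i′) (2 + k)) (proj₂ mi′)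
    r′<q : base c + i′ < base c + suc i′
    r′<q = +-monoʳ-< (base c) ≤-refl
    ml : Mid k l
    ml = <⇒≤ hl , linear 3 (+-mono-≤ (proj₂ mi) l<i) (solve (N ∷ k ∷ i ∷ l ∷ []))
  ... | no ¬hl = base c + l , base-bound c (<-trans l<i′ i′<N) , +-monoʳ-< (base c) l<i′ , same ,
        both-near b b′ (+-monoʳ-< (base c) l<i) (cluster-near c i<N)
                       (+-monoʳ-< (base c) l<i′) (cluster-near c i′<N) ,
        answer
    where
    i<N : suc i < N
    i<N = ≤-<-trans (m≤n+m (suc i) (2 + k)) (proj₂ mi)
    i′<N : suc i′ < N
    i′<N = ≤-<-trans (m≤n+m (suc i′) (2 + k)) (proj₂ mi′)
    l<i′ : l < suc i′
    l<i′ = linear 1 (+-mono-≤ (proj₁ mi′) (≰⇒> ¬hl)) (solve (k ∷ i′ ∷ l ∷ []))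
    l<pred : l < i
    l<pred = linear 0 (+-mono-≤ (proj₁ mi) (≰⇒> ¬hl)) (solve (k ∷ i ∷ l ∷ []))
    answer : ∀ s′ → base c + l < s′ → s′ < base c + suc i′ →
             ∃ λ s → base c + l < s × s < base c + suc i × Sim k s s′
    answer s′ lo hi with between c lo hi
    ... | j , refl , l<j , j<i′ with down c mi mi′ j<i′
    ...   | h , h<i , inj₁ refl , sim = base c + h , +-monoʳ-< (base c) l<pred , +-monoʳ-< (base c) h<i , sim
    ...   | h , h<i , inj₂ refl , sim = base c + h , +-monoʳ-< (base c) l<j , +-monoʳ-< (base c) h<i , sim

  -- Replies across the two clusters.

  up-cross : ∀ {k i i′ j l} → Mid (2 + k) i → Mid (2 + k) i′ → i′ < j → j < N →
             ∃ λ s → i < s × s < N + l × Sim k s j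
  up-cross {k} {i} {l = l} mi mi′ i′<j j<N with up false mi mi′ i′<j
  ... | h , i<h , inj₁ refl , sim = h , i<h , <-≤-trans si<N (m≤m+n N l) , sim
    where
    si<N : suc i < N
    si<N = ≤-<-trans (m≤n+m (suc i) k) (proj₂ (Mid-suc {k} mi))
  ... | h , i<h , inj₂ refl , sim = h , i<h , <-≤-trans j<N (m≤m+n N l) , sim

  down-cross : ∀ {k i i′ j l} → Mid (2 + k) i → Mid (2 + k) i′ → j < i′ → l < N →
               ∃ λ s → l < s × s < N + i × Sim k s (N + j)
  down-cross {i = suc i} mi mi′ j<i′ l<N with down true mi mi′ j<i′
  ... | h , h<i , _ , sim = N + h , <-≤-trans l<N (m≤m+n N h) , +-monoʳ-< N h<i , sim

  -- A target near an end of the second cluster is its own reply, on the same side of `i` and `i′`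
  -- by index order. A deep target is answered by a neighbour of the counterpart of `i′`: the one
  -- before it for a near move, the one after it for a far move. The counterpart itself, whose side
  -- may depend on the word, is avoided.
  cross-right : ∀ {k b b′ i i′ l} → Mid (2 + k) i → Mid (2 + k) i′ → l < N →
                Right k b b′ i i′ (N + l)
  cross-right {k} {b} {b′} {i} {i′} {l} mi mi′ l<N = cases (l ≤? k) (suc k + l <? N)
    where
    i<N : i < N
    i<N = ≤-<-trans (m≤n+m i (2 + k)) (proj₂ mi)
    i′<N : i′ < N
    i′<N = ≤-<-trans (m≤n+m i′ (2 + k)) (proj₂ mi′)
    crosses : ∀ {h} j → h < N → h < N + j
    crosses j h<N = <-≤-trans h<N (m≤m+n N j)
    stay : SameCell b i (N + l) b′ i′ (N + l) → Right k b b′ i i′ (N + l)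
    stay cell = N + l , +-monoʳ-< N l<N , crosses l i′<N , same , cell , answer
      where
      answer : ∀ s′ → i′ < s′ → s′ < N + l → ∃ λ s → i < s × s < N + l × Sim k s s′
      answer s′ lo hi with view s′ (<-trans hi (+-monoʳ-< N l<N))
      ... | inCluster false j<N     = up-cross {l = l} mi mi′ lo j<N
      ... | inCluster true {j} j<N = N + j , crosses j i<N , hi , same
    move : k < l → suc k + l < N → ∀ {l′} → Mid k l′ →
           SameCell b i (N + l) b′ i′ (N + l′) → Right k b b′ i i′ (N + l)
    move k<l hl {l′} ml′ cell = N + l′ , +-monoʳ-< N l′<N , crosses l′ i′<N ,
      mid true (<⇒≤ k<l , <⇒≤ hl) ml′ , cell , answer
      where
      l′<N : l′ < N
      l′<N = ≤-<-trans (m≤n+m l′ k) (proj₂ ml′)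
      mk : Mid k k
      mk = ≤-refl , <-trans (+-monoʳ-< k k<l) (<⇒≤ hl)
      answer : ∀ s′ → i′ < s′ → s′ < N + l′ → ∃ λ s → i < s × s < N + l × Sim k s s′
      answer s′ lo hi with view s′ (<-trans hi (+-monoʳ-< N l′<N))
      ... | inCluster false j<N = up-cross {l = l} mi mi′ lo j<N
      ... | inCluster true {j} j<N with k ≤? j
      -- `N + k` is the first event of the second cluster with margin `k`; it precedes the target
      -- and answers for every deep `j`.
      ...   | yes k≤j = N + k , crosses k i<N , +-monoʳ-< N k<l ,
                        mid true mk (k≤j , <-trans (+-monoʳ-< k (+-cancelˡ-< N j l′ hi)) (proj₂ ml′))
      ...   | no k≰j  = N + j , crosses j i<N , +-monoʳ-< N (<-trans (≰⇒> k≰j) k<l) , same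
    choose : ∀ {i′} → Mid (2 + k) i′ → i′ < N →
             Cell b 0 i (N + l) ⊎ Cell b 1 i (N + l) →
             ∃ λ l′ → Mid k l′ × SameCell b i (N + l) b′ i′ (N + l′)
    choose {suc h} mh h<N (inj₁ cell) =
      h , Mid-pred mh , 0 , cell , near b′ (crosses h h<N) (+-monoʳ-< N ≤-refl)
    choose {h} mh h<N (inj₂ cell) =
      suc h , Mid-suc mh , 1 , cell , far b′ (+-monoʳ-< N ≤-refl)
        (+-monoʳ-< N (≤-<-trans (m≤n+m (suc h) k) (proj₂ (Mid-suc {k} mh))))
    cases : Dec (l ≤ k) → Dec (suc k + l < N) → Right k b b′ i i′ (N + l)
    cases (yes l≤k) _ = stay (both-near b b′ (crosses l i<N) (+-monoʳ-< N (below mi))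
                                             (crosses l i′<N) (+-monoʳ-< N (below mi′)))
      where
      below : ∀ {h} → Mid (2 + k) h → l < h
      below (lo , _) = ≤-trans (s≤s l≤k) (≤-trans (n≤1+n (suc k)) lo)
    cases (no _) (no ¬hl) = stay (both-far b b′ (+-monoʳ-< N (above mi)) (+-monoʳ-< N l<N)
                                                (+-monoʳ-< N (above mi′)) (+-monoʳ-< N l<N))
      where
      above : ∀ {h} → Mid (2 + k) h → h < l
      above {h} (_ , hi) = linear 1 (+-mono-≤ hi (≮⇒≥ ¬hl)) (solve (N ∷ k ∷ h ∷ l ∷ []))
    -- Only here can `N + l` be the counterpart of `i`, so the actual cell of the original move is
    -- consulted.
    cases (no l≰k) (yes hl)
      with choose mi′ i′<N (near-or-far b (crosses l i<N) (+-monoʳ-< N l<N))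
    ... | l′ , ml′ , cell = move (≰⇒> l≰k) hl ml′ cell

  -- Mirror image of `cross-right`. Leftwards a smaller target index means a longer distance, so the
  -- successor of `i′` answers near moves and the predecessor far ones.
  cross-left : ∀ {k b b′ i i′ l} → Mid (2 + k) i → Mid (2 + k) i′ → l < N →
               Left k b b′ (N + i) (N + i′) l
  cross-left {k} {b} {b′} {i} {i′} {l} mi mi′ l<N = cases (l ≤? k) (suc k + l <? N)
    where
    i<N : i < N
    i<N = ≤-<-trans (m≤n+m i (2 + k)) (proj₂ mi)
    i′<N : i′ < N
    i′<N = ≤-<-trans (m≤n+m i′ (2 + k)) (proj₂ mi′)
    crosses : ∀ {h} j → h < N → h < N + j
    crosses j h<N = <-≤-trans h<N (m≤m+n N j)
    stay : SameCell b l (N + i) b′ l (N + i′) → Left k b b′ (N + i) (N + i′) l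
    stay cell = l , crosses N l<N , crosses i′ l<N , same , cell , answer
      where
      answer : ∀ s′ → l < s′ → s′ < N + i′ → ∃ λ s → l < s × s < N + i × Sim k s s′
      answer s′ lo hi with view s′ (<-trans hi (+-monoʳ-< N i′<N))
      ... | inCluster false {j} j<N = j , lo , crosses i j<N , same
      ... | inCluster true {j} j<N  = down-cross mi mi′ (+-cancelˡ-< N j i′ hi) l<N
    move : k < l → suc k + l < N → ∀ {l′} → Mid k l′ →
           SameCell b l (N + i) b′ l′ (N + i′) → Left k b b′ (N + i) (N + i′) l
    move k<l hl {l′} ml′ cell = l′ , crosses N l′<N , crosses i′ l′<N ,
      mid false (<⇒≤ k<l , <⇒≤ hl) ml′ , cell , answer
      where
      l′<N : l′ < N
      l′<N = ≤-<-trans (m≤n+m l′ k) (proj₂ ml′)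
      ml : Mid k (suc l)
      ml = ≤-trans (<⇒≤ k<l) (n≤1+n l) , subst (_< N) (sym (+-suc k l)) hl
      answer : ∀ s′ → l′ < s′ → s′ < N + i′ → ∃ λ s → l < s × s < N + i × Sim k s s′
      answer s′ lo hi with view s′ (<-trans hi (+-monoʳ-< N i′<N))
      ... | inCluster true {j} j<N = down-cross mi mi′ (+-cancelˡ-< N j i′ hi) l<N
      ... | inCluster false {j} j<N with k + j <? N
      -- The extra one in `suc k + l < N` keeps `suc l` deep, so it answers for every deep `j`.
      ...   | yes hj = suc l , ≤-refl , crosses i (≤-<-trans (m≤n+m (suc l) k) (proj₂ ml)) ,
                       mid false ml (≤-trans (proj₁ ml′) (<⇒≤ lo) , hj)
      ...   | no ¬hj = j , linear 1 (+-mono-≤ hl (≮⇒≥ ¬hj)) (solve (N ∷ k ∷ l ∷ j ∷ [])) ,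
                       crosses i j<N , same
    choose : ∀ {i′} → Mid (2 + k) i′ → i′ < N →
             Cell b 0 l (N + i) ⊎ Cell b 1 l (N + i) →
             ∃ λ l′ → Mid k l′ × SameCell b l (N + i) b′ l′ (N + i′)
    choose {h} mh h<N (inj₁ cell) =
      suc h , Mid-suc mh , 0 , cell ,
        near b′ (crosses h (≤-<-trans (m≤n+m (suc h) k) (proj₂ (Mid-suc {k} mh)))) (+-monoʳ-< N ≤-refl)
    choose {suc h} mh h<N (inj₂ cell) =
      h , Mid-pred mh , 1 , cell , far b′ (+-monoʳ-< N ≤-refl) (+-monoʳ-< N h<N)
    cases : Dec (l ≤ k) → Dec (suc k + l < N) → Left k b b′ (N + i) (N + i′) l
    cases (yes l≤k) _ = stay (both-far b b′ (+-monoʳ-< N (below mi)) (+-monoʳ-< N i<N)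
                                            (+-monoʳ-< N (below mi′)) (+-monoʳ-< N i′<N))
      where
      below : ∀ {h} → Mid (2 + k) h → l < h
      below (lo , _) = ≤-trans (s≤s l≤k) (≤-trans (n≤1+n (suc k)) lo)
    cases (no _) (no ¬hl) = stay (both-near b b′ (crosses i l<N) (+-monoʳ-< N (above mi))
                                                 (crosses i′ l<N) (+-monoʳ-< N (above mi′)))
      where
      above : ∀ {h} → Mid (2 + k) h → h < l
      above {h} (_ , hi) = linear 1 (+-mono-≤ hi (≮⇒≥ ¬hl)) (solve (N ∷ k ∷ h ∷ l ∷ []))
    cases (no l≰k) (yes hl)
      with choose mi′ i′<N (near-or-far b (crosses i l<N) (+-monoʳ-< N i<N))
    ... | l′ , ml′ , cell = move (≰⇒> l≰k) hl ml′ cell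

  -- Replies to arbitrary moves.

  mid-right : ∀ c {k b b′ i i′ r} → Mid (2 + k) i → Mid (2 + k) i′ →
              base c + i < r → r < N + N → Right k b b′ (base c + i) (base c + i′) r
  mid-right c {r = r} mi mi′ p<r r<2N with view r r<2N
  mid-right false mi mi′ p<r r<2N | inCluster false l<N = inside-right false mi mi′ p<r l<N
  mid-right false mi mi′ p<r r<2N | inCluster true l<N  = cross-right mi mi′ l<N
  mid-right true {i = i} mi mi′ p<r r<2N | inCluster true {l} l<N =
    inside-right true mi mi′ (+-cancelˡ-< N i l p<r) l<N
  mid-right true {i = i} mi mi′ p<r r<2N | inCluster false l<N =
    ⊥-elim (<⇒≱ (<-trans p<r l<N) (m≤m+n N i))

  mid-left : ∀ c {k b b′ i i′ r} → Mid (2 + k) i → Mid (2 + k) i′ →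
             r < base c + i → r < N + N → Left k b b′ (base c + i) (base c + i′) r
  mid-left c {r = r} mi mi′ r<p r<2N with view r r<2N
  mid-left false mi mi′ r<p r<2N | inCluster false l<N = inside-left false mi mi′ r<p
  mid-left true mi mi′ r<p r<2N | inCluster false l<N  = cross-left mi mi′ l<N
  mid-left true {i = i} mi mi′ r<p r<2N | inCluster true {l} l<N =
    inside-left true mi mi′ (+-cancelˡ-< N l i r<p)
  mid-left false {k} {i = i} mi mi′ r<p r<2N | inCluster true {l} l<N =
    ⊥-elim (<⇒≱ (<-trans r<p (≤-<-trans (m≤n+m i (2 + k)) (proj₂ mi))) (m≤m+n N l))

  -- From identical positions the target is its own reply, except at `m`, whose counterpart may
  -- change cell. There `m`, being deep, is treated as a middle event paired with itself.
  step-right : ∀ {k b b′ p q r} → Mid (2 + k) m → Sim (2 + k) p q → p < r → r < N + N →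
               Right k b b′ p q r
  step-right mm (mid c mi mi′) p<r r<2N = mid-right c mi mi′ p<r r<2N
  step-right {b = b} {b′} {p} {r = r} mm same p<r r<2N with p ≟ m
  ... | yes refl = mid-right false mm mm p<r r<2N
  ... | no p≢m   = r , r<2N , p<r , same , same-cell b b′ p<r r<2N (λ _ → p≢m) ,
                   λ s′ lo hi → s′ , lo , hi , same

  -- Leftwards the critical pair is entered from its later member, so the exceptional position is
  -- `N + m`.
  step-left : ∀ {k b b′ p q r} → Mid (2 + k) m → Sim (2 + k) p q → r < p → p < N + N →
              Left k b b′ p q r
  step-left mm (mid c mi mi′) r<p p<2N = mid-left c mi mi′ r<p (<-trans r<p p<2N)
  step-left {b = b} {b′} {p} {r = r} mm same r<p p<2N with p ≟ N + m
  ... | yes refl = mid-left true mm mm r<p (<-trans r<p p<2N)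
  ... | no p≢N+m = r , <-trans r<p p<2N , r<p , same ,
                   same-cell b b′ r<p p<2N (λ p≡N+r r≡m → p≢N+m (trans p≡N+r (cong (N +_) r≡m))) ,
                   λ s′ lo hi → s′ , lo , hi , same

-- Ordered field arithmetic and integer cells.

module OrderedField (R : RealField) where
  open RealField R
    using (ℝ; 0ℝ; 1ℝ; fromℕ; isCommutativeRing; isStrictTotalOrder; 0<1; inverse; *-pos)
    renaming (_+_ to _⊕_; _*_ to _⊗_; -_ to ⊝_; _-_ to _⊖_; _<_ to _≺_; _≤_ to _≼_; +-mono-< to ⊕-mono)
  open Semantics R using (_∈L_; _∈U_; _∈I_)

  commutativeRing : CommutativeRing _ _
  commutativeRing = record { isCommutativeRing = isCommutativeRing }

  private
    module Rg = CommutativeRing commutativeRing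
    module Gp = GroupProperties Rg.+-abelianGroup
    module RgP = RingProperties Rg.ring
    module O = IsStrictTotalOrder isStrictTotalOrder

  ≼-≺-trans : ∀ {x y z} → x ≼ y → y ≺ z → x ≺ z
  ≼-≺-trans (inj₁ x≺y) y≺z = O.trans x≺y y≺z
  ≼-≺-trans (inj₂ refl) y≺z = y≺z

  ≺-≼-trans : ∀ {x y z} → x ≺ y → y ≼ z → x ≺ z
  ≺-≼-trans x≺y (inj₁ y≺z) = O.trans x≺y y≺z
  ≺-≼-trans x≺y (inj₂ refl) = x≺y

  ≺-irrefl : ∀ {x} → ¬ (x ≺ x)
  ≺-irrefl = O.irrefl refl

  shift-≺ : ∀ {x y x′ y′} z → x ⊕ z ≡ x′ → y ⊕ z ≡ y′ → x ≺ y → x′ ≺ y′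
  shift-≺ {x} {y} z refl refl x≺y = ⊕-mono x y z x≺y

  neg-anti : ∀ {x y} → x ≺ y → ⊝ y ≺ ⊝ x
  neg-anti {x} {y} = shift-≺ (⊝ x ⊕ ⊝ y) x-cancels y-cancels
    where
    x-cancels : x ⊕ (⊝ x ⊕ ⊝ y) ≡ ⊝ y
    x-cancels = Gp.\\-leftDividesˡ x (⊝ y)
    y-cancels : y ⊕ (⊝ x ⊕ ⊝ y) ≡ ⊝ x
    y-cancels = trans (cong (y ⊕_) (Rg.+-comm (⊝ x) (⊝ y))) (Gp.\\-leftDividesˡ y (⊝ x))

  ⊖-lower : ∀ {a b c} → a ⊕ c ≺ b → c ≺ b ⊖ a
  ⊖-lower {a} {b} {c} = shift-≺ (⊝ a) (Gp.xyx⁻¹≈y a c) refl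

  ⊖-upper : ∀ {a b c} → b ≺ a ⊕ c → b ⊖ a ≺ c
  ⊖-upper {a} {b} {c} = shift-≺ (⊝ a) refl (Gp.xyx⁻¹≈y a c)

  ⊖-swap-upper : ∀ {a b c} → a ⊕ c ≺ b → a ⊖ b ≺ ⊝ c
  ⊖-swap-upper {a} {b} {c} h = subst (_≺ ⊝ c) (Gp.⁻¹-anti-homo‿- b a) (neg-anti (⊖-lower h))

  ⊖-swap-lower : ∀ {a b c} → b ≺ a ⊕ c → ⊝ c ≺ a ⊖ b
  ⊖-swap-lower {a} {b} {c} h = subst (⊝ c ≺_) (Gp.⁻¹-anti-homo‿- b a) (neg-anti (⊖-upper h))

  ⊖-swap-≡ : ∀ a c → a ⊖ (a ⊕ c) ≡ ⊝ c
  ⊖-swap-≡ a c = trans (sym (Gp.⁻¹-anti-homo‿- (a ⊕ c) a)) (cong ⊝_ (Gp.xyx⁻¹≈y a c))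

  StrictMono : (ℕ → ℝ) → Set
  StrictMono f = ∀ {a b} → a < b → f a ≺ f b

  reflect-≺ : ∀ {f a b} → StrictMono f → f a ≺ f b → a < b
  reflect-≺ {f} {a} {b} mono fa≺fb with <-cmp a b
  ... | tri< a<b _ _  = a<b
  ... | tri≈ _ refl _ = ⊥-elim (≺-irrefl fa≺fb)
  ... | tri> _ _ b<a  = ⊥-elim (≺-irrefl (O.trans fa≺fb (mono b<a)))

  weak-mono : ∀ {f a b} → StrictMono f → a ≤ b → f a ≼ f b
  weak-mono mono a≤b with m≤n⇒m<n∨m≡n a≤b
  ... | inj₁ a<b  = inj₁ (mono a<b)
  ... | inj₂ refl = inj₂ refl

  additive-mono : ∀ {f} → (∀ a b → f (a + b) ≡ f a ⊕ f b) → (∀ d → 0ℝ ≺ f (suc d)) → StrictMono f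
  additive-mono {f} add pos {a} a<b with m≤n⇒∃[o]m+o≡n a<b
  ... | d , refl = subst (λ n → f a ≺ f n) (+-suc a d)
    (shift-≺ (f a) (Rg.+-identityˡ (f a)) (trans (Rg.+-comm _ _) (sym (add a (suc d)))) (pos d))

  fromℕ-+ : ∀ a b → fromℕ (a + b) ≡ fromℕ a ⊕ fromℕ b
  fromℕ-+ zero    b = sym (Rg.+-identityˡ (fromℕ b))
  fromℕ-+ (suc a) b = trans (cong (1ℝ ⊕_) (fromℕ-+ a b)) (sym (Rg.+-assoc 1ℝ (fromℕ a) (fromℕ b)))

  fromℕ-* : ∀ a b → fromℕ (a * b) ≡ fromℕ a ⊗ fromℕ b
  fromℕ-* zero    b = sym (Rg.zeroˡ (fromℕ b))
  fromℕ-* (suc a) b = trans (fromℕ-+ b (a * b)) (sym (trans (Rg.distribʳ (fromℕ b) 1ℝ (fromℕ a))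
    (trans (cong (_⊕ (fromℕ a ⊗ fromℕ b)) (Rg.*-identityˡ (fromℕ b))) (cong (fromℕ b ⊕_) (sym (fromℕ-* a b))))))

  fromℕ-pos : ∀ n → 0ℝ ≺ fromℕ (suc n)
  fromℕ-pos zero    = subst (0ℝ ≺_) (sym (Rg.+-identityʳ 1ℝ)) 0<1
  fromℕ-pos (suc n) = O.trans (fromℕ-pos n)
    (shift-≺ (fromℕ (suc n)) (Rg.+-identityˡ _) refl 0<1)

  fromℕ-mono : StrictMono fromℕ
  fromℕ-mono = additive-mono fromℕ-+ fromℕ-pos

  -- A negative `y` would make `x ⊗ (⊝ y)`, which is `⊝ 1ℝ`, positive.
  inverse-pos : ∀ {x y} → 0ℝ ≺ x → x ⊗ y ≡ 1ℝ → 0ℝ ≺ y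
  inverse-pos {x} {y} 0≺x xy≡1 with O.compare 0ℝ y
  ... | tri< 0≺y _ _  = 0≺y
  ... | tri≈ _ refl _ = ⊥-elim (≺-irrefl (subst (0ℝ ≺_) (trans (sym xy≡1) (Rg.zeroʳ x)) 0<1))
  ... | tri> _ _ y≺0  = ⊥-elim (≺-irrefl (O.trans 0<1 (subst (_≺ 0ℝ) (Gp.⁻¹-involutive 1ℝ) ⊝⊝1≺0)))
    where
    0≺-1 : 0ℝ ≺ ⊝ 1ℝ
    0≺-1 = subst (0ℝ ≺_) (trans (sym (RgP.-‿distribʳ-* x y)) (cong ⊝_ xy≡1))
             (*-pos x (⊝ y) 0≺x (subst (_≺ ⊝ y) Gp.ε⁻¹≈ε (neg-anti y≺0)))
    ⊝⊝1≺0 : ⊝ (⊝ 1ℝ) ≺ 0ℝ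
    ⊝⊝1≺0 = subst (⊝ (⊝ 1ℝ) ≺_) Gp.ε⁻¹≈ε (neg-anti 0≺-1)

  InCell : ℕ → ℝ → Set
  InCell n x = fromℕ n ≺ x × x ≺ fromℕ (suc n)

  below-cell : ∀ c n {y} → fromℕ c ≺ fromℕ (suc n) → fromℕ n ≺ y → fromℕ c ≺ y
  below-cell c n h n≺y =
    ≼-≺-trans (weak-mono fromℕ-mono (≤-pred (reflect-≺ {a = c} {b = suc n} fromℕ-mono h))) n≺y

  above-cell : ∀ c n {y} → fromℕ n ≺ fromℕ c → y ≺ fromℕ (suc n) → y ≺ fromℕ c
  above-cell c n h y≺1+n =
    ≺-≼-trans y≺1+n (weak-mono fromℕ-mono (reflect-≺ {a = n} {b = c} fromℕ-mono h))

  -- Endpoints are natural numbers, so none falls strictly inside a cell and membership is constant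
  -- there.
  ∈L-cell : ∀ n {x y} l → InCell n x → InCell n y → x ∈L l → y ∈L l
  ∈L-cell n (closedL c) (_ , x≺) (≺y , _) h = inj₁ (below-cell c n (≼-≺-trans h x≺) ≺y)
  ∈L-cell n (openL c)   (_ , x≺) (≺y , _) h = below-cell c n (O.trans h x≺) ≺y

  ∈U-cell : ∀ n {x y} u → InCell n x → InCell n y → x ∈U u → y ∈U u
  ∈U-cell n (closedU c) (≺x , _) (_ , y≺) h = inj₁ (above-cell c n (≺-≼-trans ≺x h) y≺)
  ∈U-cell n (openU c)   (≺x , _) (_ , y≺) h = above-cell c n (O.trans ≺x h) y≺
  ∈U-cell n ∞ _ _ _ = _

  ∈I-cell : ∀ n {x y} I → InCell n x → InCell n y → x ∈I I → y ∈I I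
  ∈I-cell n ⟨ l , u ⟩ cx cy (hl , hu) = ∈L-cell n l cx cy hl , ∈U-cell n u cx cy hu

  -- Embedding integer times into the reals.

  module Grid (M : ℕ) where

    ε : ℝ
    ε = proj₁ (inverse (fromℕ (suc M)) (λ e → ≺-irrefl (subst (0ℝ ≺_) e (fromℕ-pos M))))

    M⊗ε≡1 : fromℕ (suc M) ⊗ ε ≡ 1ℝ
    M⊗ε≡1 = proj₂ (inverse (fromℕ (suc M)) (λ e → ≺-irrefl (subst (0ℝ ≺_) e (fromℕ-pos M))))

    grid : ℕ → ℝ
    grid t = fromℕ t ⊗ ε

    grid-+ : ∀ a b → grid (a + b) ≡ grid a ⊕ grid b
    grid-+ a b = trans (cong (_⊗ ε) (fromℕ-+ a b)) (Rg.distribʳ ε (fromℕ a) (fromℕ b))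

    grid-0 : grid 0 ≡ 0ℝ
    grid-0 = Rg.zeroˡ ε

    grid-unit : ∀ n → grid (n * suc M) ≡ fromℕ n
    grid-unit n = trans (cong (_⊗ ε) (fromℕ-* n (suc M))) (trans (Rg.*-assoc (fromℕ n) (fromℕ (suc M)) ε)
      (trans (cong (fromℕ n ⊗_) M⊗ε≡1) (Rg.*-identityʳ (fromℕ n))))

    grid-mono : StrictMono grid
    grid-mono = additive-mono grid-+
      (λ d → *-pos (fromℕ (suc d)) ε (fromℕ-pos d) (inverse-pos (fromℕ-pos M) M⊗ε≡1))

    grid-shift : ∀ a n → grid (a + n * suc M) ≡ grid a ⊕ fromℕ n
    grid-shift a n = trans (grid-+ a (n * suc M)) (cong (grid a ⊕_) (grid-unit n))

    grid-above : ∀ {a b} n → a + n * suc M < b → grid a ⊕ fromℕ n ≺ grid b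
    grid-above {a} {b} n h = subst (_≺ grid b) (grid-shift a n) (grid-mono h)

    grid-below : ∀ {a b} n → b < a + n * suc M → grid b ≺ grid a ⊕ fromℕ n
    grid-below {a} {b} n h = subst (grid b ≺_) (grid-shift a n) (grid-mono h)

    grid-cell : ∀ {a b} n → a + n * suc M < b → b < a + suc n * suc M → InCell n (grid b ⊖ grid a)
    grid-cell n lo hi = ⊖-lower (grid-above n lo) , ⊖-upper (grid-below (suc n) hi)

    -- Guards take frozen minus current time, so "more than one unit later" becomes "below minus
    -- one".
    lt-unit : ∀ {a b} → a + 1 * suc M < b → grid a ⊖ grid b ≺ ⊝ fromℕ 1
    lt-unit h = ⊖-swap-upper (grid-above 1 h)

    gt-unit : ∀ {a b} → b < a + 1 * suc M → ⊝ fromℕ 1 ≺ grid a ⊖ grid b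
    gt-unit h = ⊖-swap-lower (grid-below 1 h)

    eq-unit : ∀ a → grid a ⊖ grid (a + 1 * suc M) ≡ ⊝ fromℕ 1
    eq-unit a = trans (cong (grid a ⊖_) (grid-shift a 1)) (⊖-swap-≡ (grid a) (fromℕ 1))

    lt-unit⁻¹ : ∀ {a b} → grid a ⊖ grid b ≺ ⊝ fromℕ 1 → a + 1 * suc M < b
    lt-unit⁻¹ {a} {b} h with <-cmp (a + 1 * suc M) b
    ... | tri< h< _ _   = h<
    ... | tri≈ _ refl _ = ⊥-elim (≺-irrefl (subst (_≺ ⊝ fromℕ 1) (eq-unit a) h))
    ... | tri> _ _ h>   = ⊥-elim (≺-irrefl (O.trans h (gt-unit h>)))

    gt-unit⁻¹ : ∀ {a b} → ⊝ fromℕ 1 ≺ grid a ⊖ grid b → b < a + 1 * suc M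
    gt-unit⁻¹ {a} {b} h with <-cmp b (a + 1 * suc M)
    ... | tri< h< _ _   = h<
    ... | tri≈ _ refl _ = ⊥-elim (≺-irrefl (subst (⊝ fromℕ 1 ≺_) (eq-unit a) h))
    ... | tri> _ _ h>   = ⊥-elim (≺-irrefl (O.trans h (lt-unit h>)))

-- The separating formula and the rank of MTL formulas.

-- Variable 0 is never frozen, so its guard says that y is at time 1 or later.
separator : ∀ {k} → TPTL k
separator = TPTL.¬' F (freeze 1 (F (freeze 2 (TPTL.¬' (
  guard (diff 0 le -[1+ 0 ]) ∨ F (guard (diff 1 lt -[1+ 0 ] ∧g diff 2 gt -[1+ 0 ])))))))

-- Each temporal operator costs 2, the margin lost in passing from `Mid (2 + k)` to `Mid k` when a
-- move is answered.
rank : ∀ {k} → MTL k → ℕ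
rank (MTL.atom _)   = 0
rank (φ MTL.∧ ψ)    = rank φ ⊔ rank ψ
rank (MTL.¬' φ)     = rank φ
rank (φ U[ _ ] ψ)   = 2 + (rank φ ⊔ rank ψ)
rank (φ S[ _ ] ψ)   = 2 + (rank φ ⊔ rank ψ)

to-Fin : ∀ {n} (P : ℕ → Set) {r} → r < n → P r → Σ (Fin n) λ j → P (toℕ j)
to-Fin P r<n h = fromℕ< r<n , subst P (sym (toℕ-fromℕ< r<n)) h

-- The two timed words.

module Words (R : RealField) (k N′ m : ℕ) (0<m : 0 < m) (1+m<N : suc m < suc N′) where
  open RealField R using (fromℕ) renaming (-_ to ⊝_; _-_ to _⊖_; _<_ to _≺_; _≤_ to _≼_)
  open Semantics R
  open OrderedField R

  N : ℕ
  N = suc N′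

  open Discrete N m (<-trans ≤-refl 1+m<N)
  -- The unit suc (N′ + …) is definitionally 3 * N.
  open Grid (N′ + (N + (N + 0)))

  -- All events carry one letter, so only times can distinguish the words. `len` is one less than
  -- the `N + N` positions.
  word : Bool → TimedWord (suc k)
  word b = record
    { len = N′ + N
    ; σ   = λ _ → Fin.zero
    ; τ   = λ i → grid (time b (toℕ i))
    ; τ-0 = trans (cong (λ s → grid (s + 0))
        (trans (shift-agree b false 0 (<⇒≢ 0<m)) (shift-false 0 z<s))) grid-0
    }

  word-strict : ∀ b → StrictlyMonotonic (word b)
  word-strict b i j i<j = grid-mono (time-mono b i<j)

  -- Induction on the formula, with both flags general so that negation can exchange the words. For
  -- Until and Since, the reply is the new witness, and each event before it inherits `φ` from its
  -- counterpart.
  transfer : ∀ ψ {κ b b′ p q} → rank ψ ≤ κ → Mid κ m → Sim κ (toℕ p) (toℕ q) →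
             (word b , p ⊨M ψ) → (word b′ , q ⊨M ψ)
  transfer (MTL.atom _) _ _ _ h = h
  transfer (φ MTL.∧ ψ) rk mm sim (h , h′) =
    transfer φ (m⊔n≤o⇒m≤o _ _ rk) mm sim h , transfer ψ (m⊔n≤o⇒n≤o (rank φ) _ rk) mm sim h′
  transfer (MTL.¬' φ) rk mm sim h h′ = h (transfer φ rk mm (Sim-sym sim) h′)
  transfer (φ U[ I ] ψ) {suc (suc κ)} {b} {b′} {p} {q} (s≤s (s≤s rk)) mm sim (j , p<j , hψ , hI , hφ)
    with step-right {b = b} {b′} mm sim p<j (toℕ<n j)
  ... | _ , r′<2N , reply with to-Fin (RightReply κ b b′ (toℕ p) (toℕ q) (toℕ j)) r′<2N reply
  ...   | j′ , q<j′ , simj , (n , (lo , hi) , (lo′ , hi′)) , match =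
    j′ , q<j′ , transfer ψ (m⊔n≤o⇒n≤o (rank φ) _ rk) mm′ simj hψ ,
    ∈I-cell n I (grid-cell n lo hi) (grid-cell n lo′ hi′) hI , inner
    where
    mm′ : Mid κ m
    mm′ = Mid-weaken (m≤n+m κ 2) mm
    inner : ∀ s′ → toℕ q < toℕ s′ → toℕ s′ < toℕ j′ → word b′ , s′ ⊨M φ
    inner s′ q<s′ s′<j′ with match (toℕ s′) q<s′ s′<j′
    ... | _ , p<s , s<j , sims
      with to-Fin (λ s → toℕ p < s × s < toℕ j × Sim κ s (toℕ s′)) (<-trans s<j (toℕ<n j)) (p<s , s<j , sims)
    ...   | s , p<s , s<j , sims = transfer φ (m⊔n≤o⇒m≤o _ _ rk) mm′ sims (hφ s p<s s<j)
  transfer (φ S[ I ] ψ) {suc (suc κ)} {b} {b′} {p} {q} (s≤s (s≤s rk)) mm sim (j , j<p , hψ , hI , hφ)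
    with step-left {b = b} {b′} mm sim j<p (toℕ<n p)
  ... | _ , r′<2N , reply with to-Fin (LeftReply κ b b′ (toℕ p) (toℕ q) (toℕ j)) r′<2N reply
  ...   | j′ , j′<q , simj , (n , (lo , hi) , (lo′ , hi′)) , match =
    j′ , j′<q , transfer ψ (m⊔n≤o⇒n≤o (rank φ) _ rk) mm′ simj hψ ,
    ∈I-cell n I (grid-cell n lo hi) (grid-cell n lo′ hi′) hI , inner
    where
    mm′ : Mid κ m
    mm′ = Mid-weaken (m≤n+m κ 2) mm
    inner : ∀ s′ → toℕ j′ < toℕ s′ → toℕ s′ < toℕ q → word b′ , s′ ⊨M φ
    inner s′ j′<s′ s′<q with match (toℕ s′) j′<s′ s′<q
    ... | _ , j<s , s<p , sims
      with to-Fin (λ s → toℕ j < s × s < toℕ p × Sim κ s (toℕ s′)) (<-trans s<p (toℕ<n p)) (j<s , s<p , sims)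
    ...   | s , j<s , s<p , sims = transfer φ (m⊔n≤o⇒m≤o _ _ rk) mm′ sims (hφ s j<s s<p)

  ordered-satisfies : word false , Fin.zero , ν₀ ⊨T separator
  ordered-satisfies (x , _ , y , x<y , fails) with toℕ y <? N
  ... | no y≮N = fails (inj₁ (inj₁ (subst (λ z → (z ⊖ τ (word false) y) ≺ ⊝ fromℕ 1) grid-0
        (lt-unit {0} (late (toℕ y) (≮⇒≥ y≮N))))))
    where
    late : ∀ y → N ≤ y → 0 + 1 * (3 * N) < time false y
    late y N≤y rewrite shift-right false y N≤y =
      s≤s (subst (_≤ 3 * y) (sym (*-identityˡ (3 * N))) (triple N≤y))
  -- The witness is the counterpart of `x`, overlaid just after `x` and before any later early
  -- event.
  ... | yes y<N = fails (inj₂ (separated (to-Fin Between (+-monoʳ-< N x<N)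
        (y<opposite , proj₁ (opposite-far false x<N (shift-false (toℕ x) x<N)) ,
         proj₂ (near false y<opposite (+-monoʳ-< N x<y))))))
    where
    x<N : toℕ x < N
    x<N = <-trans x<y y<N
    y<opposite : toℕ y < N + toℕ x
    y<opposite = <-≤-trans y<N (m≤m+n N (toℕ x))
    Between : ℕ → Set
    Between s = toℕ y < s × time false (toℕ x) + 1 * (3 * N) < time false s
                          × time false s < time false (toℕ y) + 1 * (3 * N)
    separated : Σ (Fin (N + N)) (λ s → Between (toℕ s)) → _
    separated (s , y<s , lo , hi) = s , y<s , lt-unit lo , gt-unit hi

  -- The counterexample is the moved event `m` with its successor: they sit at consecutive integers,
  -- so no event is overlaid strictly between them.
  swapped-fails : ¬ (word true , Fin.zero , ν₀ ⊨T separator)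
  swapped-fails sat
    with to-Fin (_≡ m) (<-≤-trans (<-trans ≤-refl 1+m<N) (m≤m+n N N)) refl
       | to-Fin (_≡ suc m) (<-≤-trans 1+m<N (m≤m+n N N)) refl
  ... | x , x≡m | y , y≡1+m =
    sat (x , subst (0 <_) (sym x≡m) 0<m , y , subst₂ _<_ (sym x≡m) (sym y≡1+m) ≤-refl , refuted)
    where
    time-x : time true (toℕ x) ≡ 2 + 3 * m
    time-x = trans (cong (time true) x≡m) (cong (_+ 3 * m) shift-defect)
    time-y : time true (toℕ y) ≡ 3 * suc m
    time-y = trans (cong (time true) y≡1+m) (cong (_+ 3 * suc m)
      (trans (shift-agree true false (suc m) (λ e → 1+n≢n e)) (shift-false (suc m) 1+m<N)))
    early : time true (toℕ y) < 0 + 1 * (3 * N)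
    early rewrite time-y = <-≤-trans (*-monoʳ-< 3 1+m<N) (≤-reflexive (sym (*-identityˡ (3 * N))))
    adjacent : ∀ {t u} → 2 + 3 * m + u < t → t < 3 * suc m + u → ⊥
    adjacent {t} {u} lo hi = <⇒≱ hi (linear 0 lo (solve (m ∷ t ∷ u ∷ [])))
    refuted : _ → ⊥
    refuted (inj₁ h) = ≺-irrefl (≺-≼-trans (gt-unit {0} early)
      (subst (λ z → (z ⊖ τ (word true) y) ≼ ⊝ fromℕ 1) (sym grid-0) h))
    refuted (inj₂ (s , _ , lo , hi)) = adjacent {u = 1 * (3 * N)}
      (subst (λ t → t + 1 * (3 * N) < time true (toℕ s)) time-x (lt-unit⁻¹ lo))
      (subst (λ t → time true (toℕ s) < t + 1 * (3 * N)) time-y (gt-unit⁻¹ hi))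

-- Inexpressibility in MTL.

not-strictly-equivalent : ∀ {k} (R : RealField) (ψ : MTL (suc k)) →
  ¬ Semantics.EquivalentOver R (Semantics.StrictlyMonotonic R) separator ψ
not-strictly-equivalent {k} R ψ equiv = swapped-fails
  (Equivalence.from (equiv (word true) (word-strict true))
  (transfer ψ ≤-refl (n≤1+n K , m≤n⇒m≤1+n ≤-refl) Discrete.same
    (Equivalence.to (equiv (word false) (word-strict false)) ordered-satisfies)))
  where
  K : ℕ
  K = rank ψ
  -- Each cluster has `2K + 3` events and the swap is at index `K + 1`, the exact middle, which
  -- gives `Mid K m`.
  open Words R k (suc (K + suc K)) (suc K) z<s (s≤s (s≤s (m≤n+m (suc K) K)))

theorem5 : (k : ℕ) → Σ (TPTL (suc k)) λ φ → (R : RealField) →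
    (¬ (∃ λ ψ → Semantics.EquivalentOver R (Semantics.StrictlyMonotonic R) φ ψ))
    × (¬ (∃ λ ψ → Semantics.EquivalentOver R (Semantics.WeaklyMonotonic R) φ ψ))
theorem5 k = separator , λ R →
  (λ (ψ , equiv) → not-strictly-equivalent R ψ equiv) ,
  (λ (ψ , equiv) → not-strictly-equivalent R ψ (λ w strict → equiv w (λ i j i<j → inj₁ (strict i j i<j))))
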